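{- For every positive integer $k$, there exists a digraph $G \in \mathcal{C}_3$ such that $\vec{\chi}(G) \geq k$.
   Context: All digraphs are finite and simple: no loops, no multiple arcs, and for two distinct vertices $u,v$ at most one of the arcs $uv$, $vu$ is present. A $k$-dicolouring of a digraph $D$ is a partition of $V(D)$ into $k$ sets $V_1,\dots,V_k$ (some possibly empty) such that each induced subdigraph $D[V_i]$ is acyclic (contains no directed cycle). The dichromatic number $\vec{\chi}(D)$ is the smallest $k$ such that $D$ admits a $k$-dicolouring. $TT_3$ denotes the transitive tournament on 3 vertices (a triangle oriented acyclically); a directed triangle is a directed cycle of length 3. $\mathcal{C}_3$ is the class of digraphs that contain no $TT_3$ as a subdigraph and contain no induced directed cycle of length at least $4$ (so every induced directed cycle is a directed triangle). -}

module Defs where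

open import Data.Bool.Base using (Bool; T)
open import Data.Fin.Base as Fin using (Fin; toℕ)
open import Data.Nat.Base using (ℕ; suc; _≤_; _≥_)
open import Data.Product.Base using (Σ-syntax; proj₁)
open import Function.Base using (_on_)
open import Function.Bundles using (_↔_)
open import Function.Definitions using (Injective)
open import Level using (0ℓ)
open import Relation.Binary.Core using (Rel)
open import Relation.Binary.Definitions using (Asymmetric)
open import Relation.Binary.PropositionalEquality.Core using (_≡_)
open import Relation.Nullary.Negation.Core using (¬_)

-- Boolean adjacency rules out multiple arcs.  Asymmetry says that at most one
-- of uv, vu is an arc and, for u = v, that there are no loops.
record Digraph : Set₁ where
  field
    V      : Set
    order  : ℕ
    finite : V ↔ Fin order
    adj    : V → V → Bool

  Arc : Rel V 0ℓ
  Arc u v = T (adj u v)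

  field
    asym : Asymmetric Arc

open Digraph public using (V; Arc)

record Subdigraph {A B : Set} (R : Rel A 0ℓ) (S : Rel B 0ℓ) : Set where
  field
    to        : A → B
    injective : Injective _≡_ _≡_ to
    preserves : ∀ {x y} → R x y → S (to x) (to y)

record InducedSubdigraph {A B : Set} (R : Rel A 0ℓ) (S : Rel B 0ℓ) : Set where
  field
    subdigraph : Subdigraph R S
  open Subdigraph subdigraph public
  field
    reflects : ∀ {x y} → S (to x) (to y) → R x y

TT₃ : Rel (Fin 3) 0ℓ
TT₃ = Fin._<_

-- The directed cycle 0 → 1 → ⋯ → ℓ-1 → 0.
data Cycle (ℓ : ℕ) (i j : Fin ℓ) : Set where
  step  : toℕ j ≡ suc (toℕ i) → Cycle ℓ i j
  close : suc (toℕ i) ≡ ℓ → toℕ j ≡ 0 → Cycle ℓ i j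

-- Lengths 1 and 2 never occur inside a simple digraph, so only 0 needs excluding.
Acyclic : {A : Set} → Rel A 0ℓ → Set
Acyclic R = ∀ ℓ → ℓ ≥ 1 → ¬ Subdigraph (Cycle ℓ) R

_[_] : (D : Digraph) (P : V D → Set) → Rel (Σ[ v ∈ V D ] P v) 0ℓ
D [ P ] = Arc D on proj₁

-- The function v ↦ (index of the part containing v) encodes a partition into k
-- possibly empty parts.
record Dicolouring (D : Digraph) (k : ℕ) : Set where
  field
    colour  : V D → Fin k
    acyclic : ∀ i → Acyclic (D [ (λ v → colour v ≡ i) ])

record IsDichromaticNumber (D : Digraph) (χ : ℕ) : Set where
  field
    attained : Dicolouring D χ
    minimal  : ∀ m → Dicolouring D m → χ ≤ m

record 𝒞₃ (D : Digraph) : Set where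
  field
    noTT₃              : ¬ Subdigraph TT₃ (Arc D)
    noLongInducedCycle : ∀ ℓ → ℓ ≥ 4 → ¬ InducedSubdigraph (Cycle ℓ) (Arc D)

{-# OPTIONS --safe #-}
module Submission where

-- Give each of k colours a level that says whether a vertex, an arc or a
-- directed triangle in that colour is forbidden.  By induction on the levels,
-- some graph of the class has no admissible colouring.  Indeed, the graph H
-- for a lower level of colour i contains, in every admissible colouring, a
-- vertex b or an arc ab of colour i.  Glue to each vertex b and each arc ab of H
-- a copy of a rooted graph K, by arcs b → w → a for every w in the stable set of
-- roots: if K always has a root avoiding a set J of colours, then one of the
-- copies has a root that also avoids i.  When J contains all colours, this is
-- a contradiction.  An induced cycle that leaves H enters a copy from b and returns
-- to a, so it is a triangle, and gluing preserves the class.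

open import Defs
open import Axiom.UniquenessOfIdentityProofs using (module Decidable⇒UIP)
open import Data.Bool.Properties using (T?)
open import Data.Empty using (⊥)
open import Data.Fin.Base as Fin using (Fin; zero; suc; toℕ; fromℕ; inject₁; inject≤; finToFun; funToFin)
open import Data.Fin.Induction using (<-weakInduction; <-weakInduction-startingFrom)
import Data.Fin.Properties as Fin
open import Data.Fin.Patterns using (0F; 1F; 2F)
open import Data.List.Base using (List; []; _∷_; allFin)
open import Data.List.Membership.Propositional using (_∉_)
open import Data.List.Membership.Propositional.Properties using (∈-allFin)
open import Data.List.Relation.Unary.Any using (here; there)
open import Data.Nat.Base using (ℕ; zero; suc; _≤_; _<_; _≥_; z≤n; s≤s)
open import Data.Nat.Induction using (Acc; acc; <-wellFounded)
import Data.Nat.Properties as ℕ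
open import Data.Product.Base using (Σ-syntax; ∃-syntax; ∃; _×_; _,_; proj₁; proj₂)
open import Data.Product.Function.NonDependent.Propositional using (_×-↔_)
open import Data.Product.Properties using (≡-dec)
open import Data.Sum.Base using (_⊎_; inj₁; inj₂)
open import Data.Sum.Function.Propositional using (_⊎-↔_)
open import Data.Unit.Base using (⊤; tt)
open import Data.Vec.Base using (Vec; []; _∷_; lookup; _[_]≔_; replicate)
open import Data.Vec.Properties using (lookup∘update; lookup∘update′; lookup-replicate)
open import Function.Base using (_∘_; id)
open import Function.Bundles using (_↔_; Inverse; Injection)
open import Function.Properties.Inverse using (↔-sym; ↔-trans; ↔⇒↣)
open import Level using (0ℓ)
open import Relation.Binary.Core using (Rel)
open import Relation.Binary.Definitions using (Asymmetric; DecidableEquality)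
import Relation.Binary.Definitions as Binary
open import Relation.Binary.PropositionalEquality
  using (_≡_; _≢_; _≗_; refl; sym; trans; cong; subst; subst₂)
open import Relation.Nullary.Decidable
  using (Dec; yes; no; ⌊_⌋; map′; _×-dec_; _→-dec_; ¬?; toWitness; fromWitness; via-injection)
open import Relation.Nullary.Negation using (¬_; contradiction)
import Relation.Unary as Unary

-- Walking along a directed cycle

-- Walk up from `i` to the last index, take the closing arc to 0, and walk up again through all
-- indices.
cycle-induction : ∀ {ℓ} (P : Fin ℓ → Set) → (∀ {i j} → Cycle ℓ i j → P i → P j) →
                  ∀ {i} → P i → ∀ j → P j
cycle-induction {suc n} P advance {i} Pi =
  <-weakInduction P (advance (close (cong suc (Fin.toℕ-fromℕ n)) refl) Plast) up
  where
  up : ∀ j → P (inject₁ j) → P (suc j)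
  up j = advance (step (cong suc (sym (Fin.toℕ-inject₁ j))))
  Plast : P (fromℕ n)
  Plast = <-weakInduction-startingFrom P Pi up (Fin.≤fromℕ i)

-- Three plain steps would raise an index by 3. One wraparound gives `ℓ` = 3, a second one forces
-- `ℓ` = 1.
cycle-returning-in-three : ∀ {ℓ} {i j k : Fin ℓ} → Cycle ℓ i j → Cycle ℓ j k → Cycle ℓ k i → ℓ ≤ 3
cycle-returning-in-three {ℓ} {i} {j} {k} = go
  where
  go : Cycle ℓ i j → Cycle ℓ j k → Cycle ℓ k i → ℓ ≤ 3
  go (step p) (step q) (step r) rewrite p | q = contradiction r (ℕ.m≢1+n+m (toℕ i) {2})
  go (step p) (step q) (close r s) rewrite p | q | s = ℕ.≤-reflexive (sym r)
  go (step p) (close q r) (step s) rewrite p | r | s = ℕ.≤-reflexive (sym q)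
  go (step p) (close q r) (close s t) rewrite r = ℕ.≤-trans (ℕ.≤-reflexive (sym s)) (s≤s z≤n)
  go (close p q) (step r) (step s) rewrite q | r | s = ℕ.≤-reflexive (sym p)
  go (close p q) (step r) (close s t) rewrite t = ℕ.≤-trans (ℕ.≤-reflexive (sym p)) (s≤s z≤n)
  go (close p q) (close r s) _ rewrite q = ℕ.≤-trans (ℕ.≤-reflexive (sym r)) (s≤s z≤n)

-- Moves an induced cycle of a glued graph into the piece that contains it. Its vertices stay
-- distinct because equal preimages under `e` have equal images.
mapInduced : {A B C : Set} {R : Rel A 0ℓ} {S : Rel B 0ℓ} {T : Rel C 0ℓ} (e : C → B) →
             (∀ {x y} → S (e x) (e y) → T x y) → (∀ {x y} → T x y → S (e x) (e y)) →
             (I : InducedSubdigraph R S) → (∀ i → ∃[ c ] InducedSubdigraph.to I i ≡ e c) →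
             InducedSubdigraph R T
mapInduced {R = R} {S} {T} e reflect preserve I factor = record
  { subdigraph = record
    { to        = λ i → proj₁ (factor i)
    ; injective = λ {i} {j} eq → injective
        (trans (proj₂ (factor i)) (trans (cong e eq) (sym (proj₂ (factor j)))))
    ; preserves = λ {i} {j} r → reflect (subst₂ S (proj₂ (factor i)) (proj₂ (factor j)) (preserves r))
    }
  ; reflects = λ {i} {j} t → reflects (subst₂ S (sym (proj₂ (factor i))) (sym (proj₂ (factor j))) (preserve t))
  }
  where open InducedSubdigraph I

-- The class with propositional arcs, and rooted graphs

-- Arcs form a decidable relation rather than a Boolean function, so that proofs can match on how an
-- arc arose. Asymmetry makes the vertices in `intransitive` distinct, so it excludes exactly `TT₃`.
record C₃Graph : Set₁ where
  infix 4 _⟶_ _⟶?_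
  field
    Carrier        : Set
    size           : ℕ
    finite         : Carrier ↔ Fin size
    _⟶_            : Rel Carrier 0ℓ
    _⟶?_           : Binary.Decidable _⟶_
    asym           : Asymmetric _⟶_
    intransitive   : ∀ {x y z} → x ⟶ y → y ⟶ z → ¬ x ⟶ z
    noInducedCycle : ∀ ℓ → ℓ ≥ 4 → ¬ InducedSubdigraph (Cycle ℓ) _⟶_

  irrefl : ∀ {x} → ¬ x ⟶ x
  irrefl r = asym r r

  _≟_ : DecidableEquality Carrier
  _≟_ = via-injection (↔⇒↣ finite) Fin._≟_

open C₃Graph using (Carrier)

toDigraph : C₃Graph → Digraph
toDigraph G = record
  { V = C₃Graph.Carrier G; order = size; finite = finite; adj = λ x y → ⌊ x ⟶? y ⌋
  ; asym = λ {x} {y} p q → asym (toWitness {a? = x ⟶? y} p) (toWitness {a? = y ⟶? x} q) }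
  where open C₃Graph G

toDigraph-𝒞₃ : ∀ G → 𝒞₃ (toDigraph G)
toDigraph-𝒞₃ G = record
  { noTT₃ = λ S → let open Subdigraph S in
      intransitive (toWitness (preserves {0F} {1F} (s≤s z≤n)))
                   (toWitness (preserves {1F} {2F} (s≤s (s≤s z≤n))))
                   (toWitness (preserves {0F} {2F} (s≤s z≤n)))
  ; noLongInducedCycle = λ ℓ ℓ≥4 I → noInducedCycle ℓ ℓ≥4
      (mapInduced id toWitness fromWitness I λ _ → _ , refl)
  }
  where open C₃Graph G

point : C₃Graph
point = record
  { Carrier = ⊤; size = 1; finite = ↔-sym Fin.1↔⊤
  ; _⟶_ = λ _ _ → ⊥; _⟶?_ = λ _ _ → no λ (); asym = λ ()
  ; intransitive = λ ()
  ; noInducedCycle = λ where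
      (suc zero) (s≤s ()) _
      (suc (suc _)) _ I → InducedSubdigraph.preserves I {0F} {1F} (step refl)
  }

record Rooted : Set₁ where
  field
    graph  : C₃Graph
    Root   : Carrier graph → Set
    root?  : Unary.Decidable Root
    stable : ∀ {v w} → Root v → Root w → ¬ C₃Graph._⟶_ graph v w

rootedPoint : Rooted
rootedPoint = record { graph = point; Root = λ _ → ⊤; root? = λ _ → yes tt; stable = λ _ _ () }

-- Gluing copies of a rooted graph

module Glue (H : C₃Graph) (K : Rooted) where
  private
    open module K = Rooted K using (Root; root?)
    module H = C₃Graph H
    module G = C₃Graph K.graph
    open H using () renaming (_⟶_ to _⟶ᴴ_)
    open G using () renaming (_⟶_ to _⟶ᴷ_)

  -- One copy of K for every pair (a , b), whose roots form directed triangles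
  -- with the arc ab; if ab is not an arc, then the arcs to a are left out.
  Vertex : Set
  Vertex = H.Carrier ⊎ ((H.Carrier × H.Carrier) × G.Carrier)

  infix 4 _⟶_
  data _⟶_ : Rel Vertex 0ℓ where
    base  : ∀ {x y} → x ⟶ᴴ y → inj₁ x ⟶ inj₁ y
    copy  : ∀ {e v w} → v ⟶ᴷ w → inj₂ (e , v) ⟶ inj₂ (e , w)
    enter : ∀ {a b w} → Root w → inj₁ b ⟶ inj₂ ((a , b) , w)
    leave : ∀ {a b w} → a ⟶ᴴ b → Root w → inj₂ ((a , b) , w) ⟶ inj₁ a

  base⁻¹ : ∀ {x y} → inj₁ x ⟶ inj₁ y → x ⟶ᴴ y
  base⁻¹ (base r) = r

  copy⁻¹ : ∀ {e v w} → inj₂ (e , v) ⟶ inj₂ (e , w) → v ⟶ᴷ w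
  copy⁻¹ (copy r) = r

  _⟶?_ : Binary.Decidable _⟶_
  inj₁ x ⟶? inj₁ y = map′ base base⁻¹ (x H.⟶? y)
  inj₁ x ⟶? inj₂ ((a , b) , w) =
    map′ (λ { (refl , r) → enter r }) (λ { (enter r) → refl , r }) (x H.≟ b ×-dec root? w)
  inj₂ ((a , b) , w) ⟶? inj₁ x =
    map′ (λ { (refl , r , s) → leave r s }) (λ { (leave r s) → refl , r , s })
         (x H.≟ a ×-dec (a H.⟶? b) ×-dec root? w)
  inj₂ (e , v) ⟶? inj₂ (f , w) =
    map′ (λ { (refl , r) → copy r }) (λ { (copy r) → refl , r }) (≡-dec H._≟_ H._≟_ e f ×-dec v G.⟶? w)

  asym : Asymmetric _⟶_
  asym (base r)  (base s)    = H.asym r s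
  asym (copy r)  (copy s)    = G.asym r s
  asym (enter _) (leave r _) = H.irrefl r
  asym (leave r _) (enter _) = H.irrefl r

  -- Two vertices of one copy with a common neighbour in `H` are roots, hence not adjacent. Two
  -- vertices of `H` and one of a copy would need a loop or the reverse of the arc ab.
  intransitive : ∀ {x y z} → x ⟶ y → y ⟶ z → ¬ x ⟶ z
  intransitive (base r)    (base s)    (base t)    = H.intransitive r s t
  intransitive (base r)    (enter _)   (enter _)   = H.irrefl r
  intransitive (copy r)    (copy s)    (copy t)    = G.intransitive r s t
  intransitive (copy r)    (leave _ u) (leave _ v) = K.stable v u r
  intransitive (enter u)   (copy r)    (enter v)   = K.stable u v r
  intransitive (enter _)   (leave r _) (base s)    = H.asym r s
  intransitive (leave _ _) (base r)    (leave _ _) = H.irrefl r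
  intransitive (leave r u) (enter v)   (copy s)    = K.stable u v s

  module _ {ℓ} (ℓ≥4 : ℓ ≥ 4) (I : InducedSubdigraph (Cycle ℓ) _⟶_) where
    open InducedSubdigraph I

    InBase : Fin ℓ → Set
    InBase i = ∃[ x ] to i ≡ inj₁ x

    InCopy : H.Carrier × H.Carrier → Fin ℓ → Set
    InCopy e i = ∃[ w ] to i ≡ inj₂ (e , w)

    arc : ∀ {i j u v} → Cycle ℓ i j → to i ≡ u → to j ≡ v → u ⟶ v
    arc c p q = subst₂ _⟶_ p q (preserves c)

    consecutive : ∀ {i j u v} → to i ≡ u → to j ≡ v → u ⟶ v → Cycle ℓ i j
    consecutive p q r = reflects (subst₂ _⟶_ (sym p) (sym q) r)

    -- A cycle that enters a copy at b can only leave it towards a.  The arcs ab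
    -- and from the first vertex in the copy to a then close a triangle.
    stays-in-copy : ∀ {i j e x} → to i ≡ inj₁ x → Cycle ℓ i j → InCopy e j →
                    ∀ {k l} → Cycle ℓ k l → InCopy e k → InCopy e l
    stays-in-copy to-i c (w , to-j) {l = l} d (v , to-k) with to l in to-l | arc c to-i to-j
    ... | inj₂ _ | _ with copy _ ← arc d to-k to-l = _ , refl
    ... | inj₁ _ | enter s with leave r _ ← arc d to-k to-l =
      contradiction
        (cycle-returning-in-three c (consecutive to-j to-l (leave r s)) (consecutive to-l to-i (base r)))
        (ℕ.<⇒≱ ℓ≥4)

    -- If `j` were in a copy, the cycle would stay there all the way round and reach `i`, which is
    -- in the base.
    stays-in-base : ∀ {i j} → Cycle ℓ i j → InBase i → InBase j
    stays-in-base {i} {j} c (x , to-i) with to j in to-j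
    ... | inj₁ y = y , refl
    ... | inj₂ (e , w) with cycle-induction (InCopy e) (stays-in-copy to-i c (w , to-j)) (w , to-j) i
    ...   | _ , to-i′ with () ← trans (sym to-i) to-i′

  noInducedCycle : ∀ ℓ → ℓ ≥ 4 → ¬ InducedSubdigraph (Cycle ℓ) _⟶_
  noInducedCycle ℓ@(suc _) ℓ≥4 I with to 0F in to-0
    where open InducedSubdigraph I
  ... | inj₁ x = H.noInducedCycle ℓ ℓ≥4 (mapInduced inj₁ base⁻¹ base I
                   (cycle-induction (InBase ℓ≥4 I) (stays-in-base ℓ≥4 I) (x , to-0)))
  ... | inj₂ (e , w) = G.noInducedCycle ℓ ℓ≥4 (mapInduced (λ v → inj₂ (e , v)) copy⁻¹ copy I
                         (cycle-induction (InCopy ℓ≥4 I e) stays (w , to-0)))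
    where
    open InducedSubdigraph I
    stays : ∀ {i j} → Cycle ℓ i j → InCopy ℓ≥4 I e i → InCopy ℓ≥4 I e j
    stays {i} {j} c (v , to-i) with to j in to-j
    ... | inj₂ _ with copy _ ← arc ℓ≥4 I c to-i to-j = _ , refl
    -- Once in the base, the cycle would never leave it, yet it passes through the copy at `0F`.
    ... | inj₁ y with cycle-induction (InBase ℓ≥4 I) (stays-in-base ℓ≥4 I) (y , to-j) 0F
    ...   | _ , to-0′ with () ← trans (sym to-0) to-0′

  graph : C₃Graph
  graph = record
    { Carrier = Vertex
    ; size = _
    ; finite = ↔-trans (H.finite ⊎-↔ copies) (↔-sym Fin.+↔⊎)
    ; _⟶_ = _⟶_
    ; _⟶?_ = _⟶?_
    ; asym = asym
    ; intransitive = intransitive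
    ; noInducedCycle = noInducedCycle
    }
    where
    anchors = ↔-trans (H.finite ×-↔ H.finite) (↔-sym Fin.*↔×)
    copies  = ↔-trans (anchors ×-↔ G.finite) (↔-sym Fin.*↔×)

  data GluedRoot : Vertex → Set where
    root : ∀ {e w} → Root w → GluedRoot (inj₂ (e , w))

  gluedRoot? : Unary.Decidable GluedRoot
  gluedRoot? (inj₁ _)       = no λ ()
  gluedRoot? (inj₂ (_ , w)) = map′ root (λ { (root r) → r }) (root? w)

  rooted : Rooted
  rooted = record
    { graph = graph; Root = GluedRoot; root? = gluedRoot?
    ; stable = λ { (root r) (root s) (copy t) → K.stable r s t } }

-- Unavoidable monochromatic patterns

-- Levels 0, 1 and 2 (or more) ask for a vertex, an arc and a directed triangle.
Mono : ∀ {k} (G : C₃Graph) → (Carrier G → Fin k) → Fin k → ℕ → Set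
Mono G φ i 0 = ∃[ x ] φ x ≡ i
Mono G φ i 1 = ∃[ x ] ∃[ y ] x ⟶ y × φ x ≡ i × φ y ≡ i
  where open C₃Graph G
Mono G φ i (suc (suc _)) =
  ∃[ x ] ∃[ y ] ∃[ z ] x ⟶ y × y ⟶ z × z ⟶ x × φ x ≡ i × φ y ≡ i × φ z ≡ i
  where open C₃Graph G

mapMono : ∀ {k} (G H : C₃Graph) (f : Carrier G → Carrier H) →
          (∀ {x y} → C₃Graph._⟶_ G x y → C₃Graph._⟶_ H (f x) (f y)) →
          ∀ {φ : Carrier H → Fin k} {i} n → Mono G (φ ∘ f) i n → Mono H φ i n
mapMono G H f hom 0 (_ , p) = _ , p
mapMono G H f hom 1 (_ , _ , r , p) = _ , _ , hom r , p
mapMono G H f hom (suc (suc _)) (_ , _ , _ , r , s , t , p) = _ , _ , _ , hom r , hom s , hom t , p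

-- Inadmissibility of `φ`, stated positively by a witness: some colour shows the pattern that its
-- level forbids.
Forced : ∀ {k} (G : C₃Graph) → Vec ℕ k → (Carrier G → Fin k) → Set
Forced G c φ = ∃[ i ] Mono G φ i (lookup c i)

mapForced : ∀ {k} (G H : C₃Graph) (f : Carrier G → Carrier H) →
            (∀ {x y} → C₃Graph._⟶_ G x y → C₃Graph._⟶_ H (f x) (f y)) →
            ∀ {φ : Carrier H → Fin k} c → Forced G c (φ ∘ f) → Forced H c φ
mapForced G H f hom c (i , m) = i , mapMono G H f hom (lookup c i) m

Unavoidable : ∀ {k} → Vec ℕ k → Set₁
Unavoidable c = Σ[ G ∈ C₃Graph ] (∀ φ → Forced G c φ)

Avoiding : ∀ {k} → Vec ℕ k → List (Fin k) → Set₁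
Avoiding c J = Σ[ K ∈ Rooted ] let open Rooted K in
  ∀ φ → Forced graph c φ ⊎ (∃[ w ] Root w × φ w ∉ J)

∉-∷ : ∀ {k} {i j : Fin k} {J} → j ≢ i → j ∉ J → j ∉ i ∷ J
∉-∷ j≢i j∉J (here j≡i) = j≢i j≡i
∉-∷ j≢i j∉J (there j∈J) = j∉J j∈J

-- At level 0 a root of colour `i` is itself forbidden, so `K` serves unchanged. At level `suc n`,
-- copies of `K` are glued to a graph `H` for level `n`.
avoid-one-more : ∀ {k} {c : Vec ℕ k} i {J} →
                 (∀ n → lookup c i ≡ suc n → Unavoidable (c [ i ]≔ n)) →
                 Avoiding c J → Avoiding c (i ∷ J)
avoid-one-more {k} {c} i {J} lower (K , avoidK) with lookup c i in cᵢ
... | zero = K , λ φ → extend φ (avoidK φ)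
  where
  open Rooted K
  extend : ∀ φ → Forced graph c φ ⊎ (∃[ w ] Root w × φ w ∉ J) →
           Forced graph c φ ⊎ (∃[ w ] Root w × φ w ∉ i ∷ J)
  extend φ (inj₁ f) = inj₁ f
  extend φ (inj₂ (w , r , φw∉J)) with φ w Fin.≟ i
  ... | yes φw≡i = inj₁ (i , subst (Mono graph φ i) (sym cᵢ) (w , φw≡i))
  ... | no  φw≢i = inj₂ (w , r , ∉-∷ φw≢i φw∉J)
... | suc n = rooted , λ φ → extend φ (forceH (φ ∘ inj₁))
  where
  H = proj₁ (lower n refl)
  forceH = proj₂ (lower n refl)
  open Rooted K using (Root) renaming (graph to G)
  open Glue H K

  Goal : (Vertex → Fin k) → Set
  Goal φ = Forced graph c φ ⊎ (∃[ v ] GluedRoot v × φ v ∉ i ∷ J)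

  -- `complete` says that a root of colour `i` in this copy enlarges the pattern found in `H` to
  -- that of level `suc n`.
  at-copy : ∀ φ e → (∀ {w} → Root w → φ (inj₂ (e , w)) ≡ i → Mono graph φ i (suc n)) → Goal φ
  at-copy φ e complete with avoidK (λ w → φ (inj₂ (e , w)))
  ... | inj₁ f = inj₁ (mapForced G graph (λ w → inj₂ (e , w)) copy c f)
  ... | inj₂ (w , r , φw∉J) with φ (inj₂ (e , w)) Fin.≟ i
  ...   | yes φw≡i = inj₁ (i , subst (Mono graph φ i) (sym cᵢ) (complete r φw≡i))
  ...   | no  φw≢i = inj₂ (inj₂ (e , w) , root r , ∉-∷ φw≢i φw∉J)

  raise : ∀ φ m → Mono H (φ ∘ inj₁) i m →
          (∀ e → (∀ {w} → Root w → φ (inj₂ (e , w)) ≡ i → Mono graph φ i (suc m)) → Goal φ) →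
          (Mono graph φ i (suc m) → Goal φ) → Goal φ
  -- Entering arcs start at the second entry of the pair, so the copy at `(x , x)` is reached from
  -- `x`.
  raise φ 0 (x , p) at _ = at (x , x) λ r q → _ , _ , enter r , p , q
  raise φ 1 (x , y , r , p , q) at _ = at (x , y) λ s t → _ , _ , _ , base r , enter s , leave r s , p , q , t
  -- From level 2 on the pattern is always a triangle, so the one in `H` is enough.
  raise φ (suc (suc m)) mono _ done = done (mapMono H graph inj₁ base (suc (suc m)) mono)

  extend : ∀ φ → Forced H (c [ i ]≔ n) (φ ∘ inj₁) → Goal φ
  extend φ (j , mono) with j Fin.≟ i
  ... | yes refl = raise φ n (subst (Mono H (φ ∘ inj₁) i) (lookup∘update i c n) mono) (at-copy φ)
                     (λ m → inj₁ (i , subst (Mono graph φ i) (sym cᵢ) m))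
  -- The level of `j` was not lowered, so its pattern in `H` is forbidden by `c` as well.
  ... | no  j≢i  = inj₁ (j , mapMono H graph inj₁ base (lookup c j)
                     (subst (Mono H (φ ∘ inj₁) j) (lookup∘update′ j≢i c n) mono))

unavoidable-step : ∀ {k} (c : Vec ℕ k) →
                   (∀ i n → lookup c i ≡ suc n → Unavoidable (c [ i ]≔ n)) → Unavoidable c
unavoidable-step {k} c lower = Rooted.graph (proj₁ avoidAll) , forced
  where
  avoid : ∀ J → Avoiding c J
  avoid []      = rootedPoint , λ φ → inj₂ (tt , tt , λ ())
  avoid (i ∷ J) = avoid-one-more {c = c} i (lower i) (avoid J)
  avoidAll = avoid (allFin k)
  forced : ∀ φ → Forced (Rooted.graph (proj₁ avoidAll)) c φ
  forced φ with proj₂ avoidAll φ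
  ... | inj₁ f             = f
  ... | inj₂ (w , _ , φw∉) = contradiction (∈-allFin (φ w)) φw∉

-- Nested induction: on the head for all tails at once, and inside it on the tail with the head
-- fixed.
decrement-induction : ∀ {k} (P : Vec ℕ k → Set₁) →
                      (∀ c → (∀ i n → lookup c i ≡ suc n → P (c [ i ]≔ n)) → P c) → ∀ c → P c
decrement-induction P rec [] = rec [] λ ()
decrement-induction {suc k} P rec (n ∷ c) = head n c
  where
  head : ∀ n c → P (n ∷ c)
  head zero    = decrement-induction (λ c → P (zero ∷ c)) λ c ih →
                   rec (zero ∷ c) λ { (suc i) → ih i }
  head (suc n) = decrement-induction (λ c → P (suc n ∷ c)) λ c ih →
                   rec (suc n ∷ c) λ { zero .n refl → head n c ; (suc i) → ih i }

unavoidable : ∀ {k} (c : Vec ℕ k) → Unavoidable c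
unavoidable = decrement-induction Unavoidable unavoidable-step

-- Existence of the dichromatic number

least : {P : ℕ → Set} → Unary.Decidable P → ∃ P → ∃[ n ] P n × (∀ m → P m → n ≤ m)
least {P} P? (n , p) = go n p (<-wellFounded n)
  where
  go : ∀ n → P n → Acc _<_ n → ∃[ n ] P n × (∀ m → P m → n ≤ m)
  go n p (acc rs) with ℕ.anyUpTo? P? n
  ... | yes (m , m<n , q) = go m q (rs m<n)
  ... | no  none          = n , p , λ m q → ℕ.≮⇒≥ λ m<n → none (m , m<n , q)

module _ {A : Set} {n} (finite : A ↔ Fin n) where
  open Inverse finite using (to; from; strictlyInverseʳ)

  -- Functions are searched through their numerical codes. Decoding recovers a function only up to
  -- pointwise equality, hence `resp`.
  anyFunctionInto? : ∀ {m} {P : (Fin m → A) → Set} → (∀ {f g} → f ≗ g → P f → P g) →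
                     Unary.Decidable P → Dec (∃ P)
  anyFunctionInto? resp P? =
    map′ (λ (c , p) → _ , p)
         (λ (f , p) → funToFin (to ∘ f) ,
           resp (λ i → sym (trans (cong from (Fin.finToFun-funToFin (to ∘ f) i)) (strictlyInverseʳ (f i)))) p)
         (Fin.any? λ c → P? (from ∘ finToFun c))

  anyFunctionFrom? : ∀ {m} {P : (A → Fin m) → Set} → (∀ {f g} → f ≗ g → P f → P g) →
                     Unary.Decidable P → Dec (∃ P)
  anyFunctionFrom? resp P? =
    map′ (λ (c , p) → _ , p)
         (λ (f , p) → funToFin (f ∘ from) ,
           resp (λ x → sym (trans (Fin.finToFun-funToFin (f ∘ from) (to x)) (cong f (strictlyInverseʳ x)))) p)
         (Fin.any? λ c → P? (finToFun c ∘ to))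

cycle? : ∀ {ℓ} → Binary.Decidable (Cycle ℓ)
cycle? {ℓ} i j with toℕ j ℕ.≟ suc (toℕ i) | suc (toℕ i) ℕ.≟ ℓ ×-dec toℕ j ℕ.≟ 0
... | yes p | _           = yes (step p)
... | no _  | yes (p , q) = yes (close p q)
... | no ¬p | no ¬q       = no λ { (step p) → ¬p p ; (close p q) → ¬q (p , q) }

module _ (D : Digraph) where
  open Digraph D using (order; finite; adj; asym)

  private
    _≟_ : DecidableEquality (V D)
    _≟_ = via-injection (↔⇒↣ finite) Fin._≟_

  -- A cycle inside a colour class, with vertices and colour proofs separated so that only functions
  -- into `V D` need be searched.
  MonoCycle : ∀ {k ℓ} → (V D → Fin k) → Fin k → (Fin ℓ → V D) → Set
  MonoCycle {ℓ = ℓ} colour i f =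
    (∀ x → colour (f x) ≡ i) × (∀ x y → f x ≡ f y → x ≡ y) × (∀ x y → Cycle ℓ x y → Arc D (f x) (f y))

  monoCycle? : ∀ {k ℓ} (colour : V D → Fin k) i → Unary.Decidable (MonoCycle {ℓ = ℓ} colour i)
  monoCycle? colour i f =
    Fin.all? (λ x → colour (f x) Fin.≟ i) ×-dec
    Fin.all? (λ x → Fin.all? λ y → (f x ≟ f y) →-dec (x Fin.≟ y)) ×-dec
    Fin.all? (λ x → Fin.all? λ y → cycle? x y →-dec T? (adj (f x) (f y)))

  monoCycle-resp : ∀ {k ℓ} {c c′ : V D → Fin k} {i} {f g : Fin ℓ → V D} → c ≗ c′ → f ≗ g →
                   MonoCycle c i f → MonoCycle c′ i g
  monoCycle-resp {c = c} c≗c′ f≗g (mono , inj , arcs) =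
    (λ x → trans (sym (c≗c′ _)) (trans (cong c (sym (f≗g x))) (mono x))) ,
    (λ x y eq → inj x y (trans (f≗g x) (trans eq (sym (f≗g y))))) ,
    (λ x y c → subst₂ (Arc D) (f≗g x) (f≗g y) (arcs x y c))

  -- The bound on `ℓ` makes this a finite check. It loses nothing, since a cycle has at most `order`
  -- distinct vertices.
  NoMonoCycle : ∀ {k} → (V D → Fin k) → Set
  NoMonoCycle colour = ∀ i {ℓ} → ℓ < suc order → ℓ ≥ 1 → ¬ ∃ (MonoCycle {ℓ = ℓ} colour i)

  noMonoCycle? : ∀ {k} → Unary.Decidable (NoMonoCycle {k})
  noMonoCycle? colour = Fin.all? λ i → ℕ.allUpTo? (λ ℓ → (1 ℕ.≤? ℓ) →-dec
    ¬? (anyFunctionInto? finite (monoCycle-resp {c = colour} (λ _ → refl)) (monoCycle? colour i))) (suc order)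

  noMonoCycle-resp : ∀ {k} {c c′ : V D → Fin k} → c ≗ c′ → NoMonoCycle c → NoMonoCycle c′
  noMonoCycle-resp c≗c′ none i ℓ< ℓ≥1 (f , m) =
    none i ℓ< ℓ≥1 (f , monoCycle-resp (λ x → sym (c≗c′ x)) (λ _ → refl) m)

  noMonoCycle⇒dicolouring : ∀ {k} → ∃ (NoMonoCycle {k}) → Dicolouring D k
  noMonoCycle⇒dicolouring (colour , none) = record
    { colour  = colour
    ; acyclic = λ i ℓ ℓ≥1 S → let open Subdigraph S in
        none i
          (s≤s (Fin.injective⇒≤ {f = Inverse.to finite ∘ proj₁ ∘ to}
             λ eq → injective (Σ-≡ (Injection.injective (↔⇒↣ finite) eq))))
          ℓ≥1
          (proj₁ ∘ to , proj₂ ∘ to , (λ x y eq → injective (Σ-≡ eq)) , λ _ _ → preserves)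
    }
    where
    -- Equality of colours is decidable, so its proofs are unique and distinct vertices of a class
    -- differ in the first component.
    Σ-≡ : ∀ {i} {u v : Σ[ v ∈ V D ] colour v ≡ i} → proj₁ u ≡ proj₁ v → u ≡ v
    Σ-≡ {u = _ , p} {_ , q} refl = cong (_ ,_) (Decidable⇒UIP.≡-irrelevant Fin._≟_ p q)

  dicolouring⇒noMonoCycle : ∀ {k} → Dicolouring D k → ∃ (NoMonoCycle {k})
  dicolouring⇒noMonoCycle C = colour , λ i _ ℓ≥1 (f , mono , inj , arcs) →
    acyclic i _ ℓ≥1 record
      { to = λ x → f x , mono x ; injective = λ eq → inj _ _ (cong proj₁ eq) ; preserves = arcs _ _ }
    where open Dicolouring C

  dicolouring? : ∀ k → Dec (Dicolouring D k)
  dicolouring? k = map′ noMonoCycle⇒dicolouring dicolouring⇒noMonoCycle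
                        (anyFunctionFrom? finite noMonoCycle-resp noMonoCycle?)

  -- A starting point for the search for the least number. With all colours distinct, a
  -- monochromatic cycle would be a loop or repeat a vertex.
  rainbow : Dicolouring D order
  rainbow = noMonoCycle⇒dicolouring (Inverse.to finite , λ where
    i {suc zero}    _ _ (f , _ , _ , arcs)      → asym (arcs 0F 0F (close refl refl)) (arcs 0F 0F (close refl refl))
    i {suc (suc _)} _ _ (f , mono , inj , _) →
      Fin.0≢1+n (inj 0F 1F (Injection.injective (↔⇒↣ finite) (trans (mono 0F) (sym (mono 1F))))))

  dichromaticNumber : ∃ (IsDichromaticNumber D)
  dichromaticNumber with least dicolouring? (order , rainbow)
  ... | χ , attained , minimal = χ , record { attained = attained ; minimal = minimal }

-- From unavoidable triangles to the lower bound

-- Read as a colouring with `k` colours, a `χ`-dicolouring would have a directed triangle in one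
-- class, which is a cycle of length 3 there.
noDicolouring : ∀ {k} (U : Unavoidable (replicate k 2)) {χ} → χ ≤ k → ¬ Dicolouring (toDigraph (proj₁ U)) χ
noDicolouring {k} (G , forced) χ≤k C with forced (λ v → inject≤ (Dicolouring.colour C v) χ≤k)
... | i , mono with subst (Mono G _ i) (lookup-replicate i 2) mono
...   | x , y , z , xy , yz , zx , p , q , r = acyclic (colour x) 3 (s≤s z≤n) record
  { to = tri ; injective = λ {a} {b} eq → injective a b (cong proj₁ eq) ; preserves = λ {a} {b} → preserves a b }
  where
  open C₃Graph G hiding (Carrier)
  open Dicolouring C
  same : ∀ {v w} → inject≤ (colour v) χ≤k ≡ i → inject≤ (colour w) χ≤k ≡ i → colour v ≡ colour w
  same p q = Fin.inject≤-injective χ≤k χ≤k _ _ (trans p (sym q))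
  tri : Fin 3 → Σ[ v ∈ Carrier G ] colour v ≡ colour x
  tri 0F = x , refl
  tri 1F = y , same q p
  tri 2F = z , same r p
  injective : ∀ a b → proj₁ (tri a) ≡ proj₁ (tri b) → a ≡ b
  injective 0F 0F _    = refl
  injective 0F 1F refl = contradiction xy irrefl
  injective 0F 2F refl = contradiction zx irrefl
  injective 1F 0F refl = contradiction xy irrefl
  injective 1F 1F _    = refl
  injective 1F 2F refl = contradiction yz irrefl
  injective 2F 0F refl = contradiction zx irrefl
  injective 2F 1F refl = contradiction yz irrefl
  injective 2F 2F _    = refl
  preserves : ∀ a b → Cycle 3 a b → Arc (toDigraph G) (proj₁ (tri a)) (proj₁ (tri b))
  preserves 0F 1F _ = fromWitness xy
  preserves 1F 2F _ = fromWitness yz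
  preserves 2F 0F _ = fromWitness zx
  preserves 0F 0F (step ())
  preserves 0F 0F (close () _)
  preserves 0F 2F (step ())
  preserves 0F 2F (close () _)
  preserves 1F 0F (step ())
  preserves 1F 0F (close () _)
  preserves 1F 1F (step ())
  preserves 1F 1F (close () _)
  preserves 2F 1F (step ())
  preserves 2F 1F (close _ ())
  preserves 2F 2F (step ())
  preserves 2F 2F (close _ ())

theorem1 : (k : ℕ) → k ≥ 1 → Σ[ G ∈ Digraph ] (𝒞₃ G × (∃[ χ ] (IsDichromaticNumber G χ × χ ≥ k)))
theorem1 k _ =
  toDigraph G , toDigraph-𝒞₃ G , χ , isχ ,
  ℕ.≮⇒≥ λ χ<k → noDicolouring U (ℕ.<⇒≤ χ<k) (IsDichromaticNumber.attained isχ)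
  where
  U = unavoidable (replicate k 2)
  G = proj₁ U
  χ = proj₁ (dichromaticNumber (toDigraph G))
  isχ = proj₂ (dichromaticNumber (toDigraph G))
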